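{- $\mathcal{L}_{\rm V}(\mathbb{RDBLP}) \cong \mathcal{L}_{\rm V}(\mathbb{RDPCH}) \cong \mathcal{L}_{\rm V}(\mathbb{RPCH}^d) \cong \mathcal{L}_{\rm V}(\mathbb{RDBLH})$ (isomorphism of lattices), where $\mathcal{L}_{\rm V}(\mathbb V)$ denotes the lattice of subvarieties of the variety $\mathbb V$, ordered by inclusion.
   Context: All algebras below have a bounded distributive lattice reduct $\langle A,\vee,\wedge,0,1\rangle$. Notation for the operations: $x^*$ is the largest $z$ with $x\wedge z=0$; $x^+$ is the least $z$ with $x\vee z=1$; $x\to y$ is the largest $z$ with $x\wedge z\le y$; $x\leftarrow y$ is the least $z$ with $y\le x\vee z$. Where ${}^*$ is not basic, $x^*:=x\to 0$; where ${}^+$ is not basic, $x^+:=x\leftarrow 1$. The regularity identity is (M): $(x\wedge x^+)\vee(y\vee y^*)\approx y\vee y^*$ (for double p-algebras it is known to be equivalent to: $x^*=y^*$ and $x^+=y^+$ imply $x=y$). $\mathbb{RDBLP}$ (regular double p-algebras): algebras $\langle A,\vee,\wedge,{}^*,{}^+,0,1\rangle$ satisfying (M). $\mathbb{RDPCH}$ (regular dually pseudocomplemented Heyting algebras): algebras $\langle A,\vee,\wedge,\to,{}^+,0,1\rangle$ satisfying (M). $\mathbb{RPCH}^d$ (regular pseudocomplemented dual Heyting algebras): algebras $\langle A,\vee,\wedge,{}^*,\leftarrow,0,1\rangle$ satisfying (M). $\mathbb{RDBLH}$ (regular double Heyting algebras): algebras $\langle A,\vee,\wedge,\to,\leftarrow,0,1\rangle$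 satisfying (M). -}

module Defs where

open import Level using (Level; suc)
open import Data.Nat.Base using (ℕ)
open import Data.Vec.Base using (Vec; []; _∷_)
open import Data.Vec.Relation.Binary.Pointwise.Inductive using (Pointwise; []; _∷_)
open import Data.Product.Base using (_×_; _,_; proj₁; proj₂; Σ-syntax)
open import Data.Sum.Base using (inj₁; inj₂; [_,_])
open import Function.Base using (id; _∘_)
open import Relation.Unary using (Pred; _∈_; _⊆_; _≐_; _∩_; _∪_)
open import Relation.Binary.Bundles using (Setoid)
open import Algebra.Lattice.Bundles.Raw using (RawLattice)
open import Algebra.Lattice.Morphism.Structures using (IsLatticeIsomorphism)
open import Algebra.Lattice.Bundles using (DistributiveLattice)
open import Algebra.Lattice.Structures using (IsDistributiveLattice)
open import Algebra.Lattice.Structures.Biased using (isDistributiveLatticeʳʲᵐ)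
import Algebra.Lattice.Properties.Lattice as LatticeProperties
open import Algebra.Core using (Op₂)
open import Relation.Binary.Core using (Rel)
import Relation.Binary.Lattice.Bundles as Ord

------------------------------------------------------------------------
-- Universal algebra

record Signature : Set₁ where
  field
    Op    : Set
    arity : Op → ℕ

open Signature public

record Algebra (S : Signature) (ℓ : Level) : Set (suc ℓ) where
  field
    setoid : Setoid ℓ ℓ
  open Setoid setoid public
  field
    interp      : (o : Op S) → Vec Carrier (arity S o) → Carrier
    interp-cong : ∀ o {xs ys} → Pointwise _≈_ xs ys → interp o xs ≈ interp o ys

data Term (S : Signature) : Set where
  var : ℕ → Term S
  op  : (o : Op S) → Vec (Term S) (arity S o) → Term S

infix 4 _≋_

record Identity (S : Signature) : Set where
  constructor _≋_
  field
    lhs rhs : Term S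

module _ {S : Signature} {ℓ : Level} (A : Algebra S ℓ) where
  open Algebra A

  eval  : (ℕ → Carrier) → Term S → Carrier
  evals : (ℕ → Carrier) → ∀ {n} → Vec (Term S) n → Vec Carrier n

  eval ρ (var i)   = ρ i
  eval ρ (op o ts) = interp o (evals ρ ts)

  evals ρ []       = []
  evals ρ (t ∷ ts) = eval ρ t ∷ evals ρ ts

  infix 4 _⊨_

  _⊨_ : Identity S → Set ℓ
  _⊨_ (s ≋ t) = ∀ ρ → eval ρ s ≈ eval ρ t

-- The level suc ℓ leaves room for the equational theory of a class of
-- algebras of level ℓ.
Identities : Signature → (ℓ : Level) → Set (suc (suc ℓ))
Identities S ℓ = Pred (Identity S) (suc ℓ)

Mod : ∀ {S ℓ} → Identities S ℓ → Pred (Algebra S ℓ) (suc ℓ)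
Mod E A = ∀ {ε} → ε ∈ E → A ⊨ ε

Th : ∀ {S ℓ} → Pred (Algebra S ℓ) (suc ℓ) → Identities S ℓ
Th K ε = ∀ {A} → A ∈ K → A ⊨ ε

record Variety (S : Signature) (ℓ : Level) : Set (suc (suc ℓ)) where
  field
    class       : Pred (Algebra S ℓ) (suc ℓ)
    identities  : Identities S ℓ
    axiomatizes : class ≐ Mod identities

open Variety public

------------------------------------------------------------------------
-- The lattice of subvarieties

Subvariety : ∀ {S ℓ} → Variety S ℓ → Set (suc (suc ℓ))
Subvariety {S} {ℓ} V = Σ[ W ∈ Variety S ℓ ] class W ⊆ class V

module _ {S : Signature} {ℓ : Level} (V : Variety S ℓ) where

  members : Subvariety V → Pred (Algebra S ℓ) (suc ℓ)
  members (W , _) = class W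

  _∧ᵥ_ : Subvariety V → Subvariety V → Subvariety V
  (K , K⊆V) ∧ᵥ (L , _) = record
    { class       = class K ∩ class L
    ; identities  = identities K ∪ identities L
    ; axiomatizes =
        (λ (A∈K , A∈L) → [ proj₁ (axiomatizes K) A∈K , proj₁ (axiomatizes L) A∈L ])
      , (λ A⊨ → proj₂ (axiomatizes K) (λ e → A⊨ (inj₁ e))
              , proj₂ (axiomatizes L) (λ e → A⊨ (inj₂ e)))
    } , λ A∈ → K⊆V (proj₁ A∈)

  -- The models of the identities common to both: the least variety
  -- containing both.
  _∨ᵥ_ : Subvariety V → Subvariety V → Subvariety V
  (K , K⊆V) ∨ᵥ (L , L⊆V) = record
    { class       = Mod (Th (class K) ∩ Th (class L))
    ; identities  = Th (class K) ∩ Th (class L)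
    ; axiomatizes = (λ {A} A⊨ {ε} → A⊨ {ε}) , (λ {A} A⊨ {ε} → A⊨ {ε})
    } , λ {A} A⊨ → proj₂ (axiomatizes V) (λ {ε} e → A⊨ {ε}
          ( (λ {B} B∈K → proj₁ (axiomatizes V) (K⊆V B∈K) e)
          , (λ {B} B∈L → proj₁ (axiomatizes V) (L⊆V B∈L) e)))

  𝓛ᵥ : Ord.Lattice (suc (suc ℓ)) (suc ℓ) (suc ℓ)
  𝓛ᵥ = record
    { Carrier   = Subvariety V
    ; _≈_       = λ K L → members K ≐ members L
    ; _≤_       = λ K L → members K ⊆ members L
    ; _∨_       = _∨ᵥ_
    ; _∧_       = _∧ᵥ_
    ; isLattice = record
      { isPartialOrder = record
        { isPreorder = record
          { isEquivalence = record
            { refl  = (λ {A} → id) , (λ {A} → id)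
            ; sym   = λ (p , q) → (λ {A} → q {A}) , (λ {A} → p {A})
            ; trans = λ (p , q) (p′ , q′) → (λ {A} → p′ {A} ∘ p) , (λ {A} → q {A} ∘ q′)
            }
          ; reflexive = λ (p , _) {A} → p {A}
          ; trans     = λ p q {A} → q {A} ∘ p
          }
        ; antisym = λ p q → (λ {A} → p {A}) , (λ {A} → q {A})
        }
      ; supremum = λ K L →
            (λ {A} A∈K {ε} e → proj₁ e A∈K)
          , (λ {A} A∈L {ε} e → proj₂ e A∈L)
          , λ (M , _) K⊆M L⊆M {A} A⊨ → proj₂ (axiomatizes M) (λ {ε} e → A⊨ {ε}
              ( (λ {B} B∈K → proj₁ (axiomatizes M) (K⊆M B∈K) e)
              , (λ {B} B∈L → proj₁ (axiomatizes M) (L⊆M B∈L) e)))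
      ; infimum = λ K L →
            (λ {A} → proj₁)
          , (λ {A} → proj₂)
          , λ M M⊆K M⊆L {A} A∈M → M⊆K A∈M , M⊆L A∈M
      }
    }

rawLattice : ∀ {c ℓ₁ ℓ₂} → Ord.Lattice c ℓ₁ ℓ₂ → RawLattice c ℓ₁
rawLattice L = record { _≈_ = _≈_; _∧_ = _∧_; _∨_ = _∨_ }
  where open Ord.Lattice L

infix 4 _≅_

_≅_ : ∀ {c ℓ₁ ℓ₂ c′ ℓ₁′ ℓ₂′} →
      Ord.Lattice c ℓ₁ ℓ₂ → Ord.Lattice c′ ℓ₁′ ℓ₂′ → Set _
L ≅ M = Σ[ f ∈ (Ord.Lattice.Carrier L → Ord.Lattice.Carrier M) ]
          IsLatticeIsomorphism (rawLattice L) (rawLattice M) f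

------------------------------------------------------------------------
-- The four languages

-- Each language adds to ∨, ∧, 0, 1 one operation `res` (either * or →)
-- and one operation `dres` (either ⁺ or ←, with `dres (x ∷ y ∷ [])` read
-- as x ← y).

data Kind : Set where
  complement implication : Kind

kindArity : Kind → ℕ
kindArity complement  = 1
kindArity implication = 2

data Symbol : Set where
  join meet zero one res dres : Symbol

Lang : Kind → Kind → Signature
Lang k k′ = record { Op = Symbol; arity = ar }
  where
  ar : Symbol → ℕ
  ar join = 2
  ar meet = 2
  ar zero = 0
  ar one  = 0
  ar res  = kindArity k
  ar dres = kindArity k′

-- Shared by terms and algebras.
module Operations {x} {X : Set x} (k k′ : Kind)
                  (⟦_⟧ : (o : Symbol) → Vec X (arity (Lang k k′) o) → X) where

  infixr 7 _∧_
  infixr 6 _∨_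
  infix  8 _* _⁺

  _∨_ _∧_ : X → X → X
  x ∨ y = ⟦ join ⟧ (x ∷ y ∷ [])
  x ∧ y = ⟦ meet ⟧ (x ∷ y ∷ [])

  𝟎 𝟏 : X
  𝟎 = ⟦ zero ⟧ []
  𝟏 = ⟦ one ⟧ []

  star : (k : Kind) → (Vec X (kindArity k) → X) → X → X
  star complement  f x = f (x ∷ [])
  star implication f x = f (x ∷ 𝟎 ∷ [])

  plus : (k : Kind) → (Vec X (kindArity k) → X) → X → X
  plus complement  f x = f (x ∷ [])
  plus implication f x = f (x ∷ 𝟏 ∷ [])

  _* _⁺ : X → X
  _* = star k ⟦ res ⟧
  _⁺ = plus k′ ⟦ dres ⟧

module Order {c ℓ} {C : Set c} {_≈_ : Rel C ℓ} {_∨_ _∧_ : Op₂ C}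
             (isDL : IsDistributiveLattice _≈_ _∨_ _∧_) where
  private
    D : DistributiveLattice c ℓ
    D = record { isDistributiveLattice = isDL }
  open IsDistributiveLattice isDL public
  open DistributiveLattice D using (lattice)
  open Ord.Lattice (LatticeProperties.∨-∧-orderTheoreticLattice lattice) public
    using (_≤_; x≤x∨y; y≤x∨y; ∨-least; x∧y≤x; x∧y≤y; ∧-greatest; antisym)
    renaming (refl to ≤-refl; trans to ≤-trans; reflexive to ≤-reflexive)

  ≤⇒∨ : ∀ {x y} → x ≤ y → (x ∨ y) ≈ y
  ≤⇒∨ {x} {y} x≤y = antisym (∨-least x≤y ≤-refl) (y≤x∨y x y)

------------------------------------------------------------------------
-- Regular algebras

module Regularity {k k′ : Kind} {ℓ : Level} (A : Algebra (Lang k k′) ℓ) where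
  open Algebra A
  open Operations k k′ interp

  infix 4 _≤_

  _≤_ : Carrier → Carrier → Set ℓ
  x ≤ y = x ≈ x ∧ y

  IsLargest IsLeast : Pred Carrier ℓ → Pred Carrier ℓ
  IsLargest P m = P m × (∀ z → P z → z ≤ m)
  IsLeast   P m = P m × (∀ z → P z → m ≤ z)

  IsResidual : (j : Kind) → (Vec Carrier (kindArity j) → Carrier) → Set ℓ
  IsResidual complement  f = ∀ x → IsLargest (λ z → x ∧ z ≈ 𝟎) (f (x ∷ []))
  IsResidual implication f = ∀ x y → IsLargest (λ z → x ∧ z ≤ y) (f (x ∷ y ∷ []))

  IsDualResidual : (j : Kind) → (Vec Carrier (kindArity j) → Carrier) → Set ℓ
  IsDualResidual complement  f = ∀ x → IsLeast (λ z → x ∨ z ≈ 𝟏) (f (x ∷ []))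
  IsDualResidual implication f = ∀ x y → IsLeast (λ z → y ≤ x ∨ z) (f (x ∷ y ∷ []))

  -- Raised to suc ℓ only to match the level of Variety.class.
  record IsRegular : Set (suc ℓ) where
    field
      isDistributiveLattice : IsDistributiveLattice _≈_ _∨_ _∧_
      minimum               : ∀ x → 𝟎 ≤ x
      maximum               : ∀ x → x ≤ 𝟏
      isResidual            : IsResidual k (interp res)
      isDualResidual        : IsDualResidual k′ (interp dres)
      regularity            : ∀ x y → (x ∧ x ⁺) ∨ (y ∨ y *) ≈ y ∨ y *

open Regularity public using (IsRegular)

------------------------------------------------------------------------
-- An equational basis, showing that each class is a variety

module EquationalBasis where

  open Regularity using (_≤_; IsResidual; IsDualResidual)

  module _ {k k′ : Kind} where
    open Operations k k′ (op {Lang k k′}) public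
      using () renaming (_∨_ to _∨ᵗ_; _∧_ to _∧ᵗ_; 𝟎 to 𝟎ᵗ; 𝟏 to 𝟏ᵗ; _* to _*ᵗ; _⁺ to _⁺ᵗ)

    infix 4 _≼_

    _≼_ : Term (Lang k k′) → Term (Lang k k′) → Identity (Lang k k′)
    s ≼ t = s ≋ s ∧ᵗ t

    x y z : Term (Lang k k′)
    x = var 0
    y = var 1
    z = var 2

  infix 8 _⇒ᵗ_ _⇐ᵗ_

  _⇒ᵗ_ : ∀ {k′} (s t : Term (Lang implication k′)) → Term (Lang implication k′)
  s ⇒ᵗ t = op res (s ∷ t ∷ [])

  _⇐ᵗ_ : ∀ {k} (s t : Term (Lang k implication)) → Term (Lang k implication)
  s ⇐ᵗ t = op dres (s ∷ t ∷ [])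

  data Basis {ℓ : Level} : (k k′ : Kind) → Identities (Lang k k′) ℓ where
    ∨-comm      : ∀ {k k′} → Basis k k′ (x ∨ᵗ y ≋ y ∨ᵗ x)
    ∨-assoc     : ∀ {k k′} → Basis k k′ ((x ∨ᵗ y) ∨ᵗ z ≋ x ∨ᵗ (y ∨ᵗ z))
    ∧-comm      : ∀ {k k′} → Basis k k′ (x ∧ᵗ y ≋ y ∧ᵗ x)
    ∧-assoc     : ∀ {k k′} → Basis k k′ ((x ∧ᵗ y) ∧ᵗ z ≋ x ∧ᵗ (y ∧ᵗ z))
    ∨-absorbs-∧ : ∀ {k k′} → Basis k k′ (x ∨ᵗ (x ∧ᵗ y) ≋ x)
    ∧-absorbs-∨ : ∀ {k k′} → Basis k k′ (x ∧ᵗ (x ∨ᵗ y) ≋ x)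
    ∨-distribʳ  : ∀ {k k′} → Basis k k′ ((y ∧ᵗ z) ∨ᵗ x ≋ (y ∨ᵗ x) ∧ᵗ (z ∨ᵗ x))
    minimum     : ∀ {k k′} → Basis k k′ (𝟎ᵗ ≼ x)
    maximum     : ∀ {k k′} → Basis k k′ (x ≼ 𝟏ᵗ)
    *-contra    : ∀ {k′} → Basis complement k′ (x ∧ᵗ x *ᵗ ≋ 𝟎ᵗ)
    *-zero      : ∀ {k′} → Basis complement k′ (𝟏ᵗ ≼ 𝟎ᵗ *ᵗ)
    *-relative  : ∀ {k′} → Basis complement k′ (y ∧ᵗ (x ∧ᵗ y) *ᵗ ≼ x *ᵗ)
    ⇒-eval      : ∀ {k′} → Basis implication k′ (x ∧ᵗ (x ⇒ᵗ y) ≼ y)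
    ⇒-unit      : ∀ {k′} → Basis implication k′ (z ≼ x ⇒ᵗ (x ∧ᵗ z))
    ⇒-mono      : ∀ {k′} → Basis implication k′ (x ⇒ᵗ (z ∧ᵗ y) ≼ x ⇒ᵗ y)
    ⁺-excl      : ∀ {k} → Basis k complement (x ∨ᵗ x ⁺ᵗ ≋ 𝟏ᵗ)
    ⁺-one       : ∀ {k} → Basis k complement (𝟏ᵗ ⁺ᵗ ≼ 𝟎ᵗ)
    ⁺-relative  : ∀ {k} → Basis k complement (x ⁺ᵗ ≼ y ∨ᵗ (x ∨ᵗ y) ⁺ᵗ)
    ⇐-eval      : ∀ {k} → Basis k implication (y ≼ x ∨ᵗ (x ⇐ᵗ y))
    ⇐-unit      : ∀ {k} → Basis k implication (x ⇐ᵗ (x ∨ᵗ z) ≼ z)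
    ⇐-mono      : ∀ {k} → Basis k implication (x ⇐ᵗ y ≼ x ⇐ᵗ (y ∨ᵗ z))
    regularity  : ∀ {k k′} → Basis k k′ ((x ∧ᵗ x ⁺ᵗ) ∨ᵗ (y ∨ᵗ y *ᵗ) ≋ y ∨ᵗ y *ᵗ)

  IsRegular⇒Mod : ∀ {k k′ ℓ} → IsRegular {k} {k′} {ℓ} ⊆ Mod (Basis k k′)
  IsRegular⇒Mod {k} {k′} {ℓ} {A} R = sound
    where
    module R = IsRegular R
    module D = Order R.isDistributiveLattice
    open D using (sym; trans; ≤-refl; ≤-trans; x≤x∨y; x∧y≤y; ≤⇒∨)
    open Operations k k′ (Algebra.interp A) using (_∨_; _∧_)

    sound : ∀ {ε} → ε ∈ Basis {ℓ} k k′ → A ⊨ ε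
    sound ∨-comm      ρ = D.∨-comm _ _
    sound ∨-assoc     ρ = D.∨-assoc _ _ _
    sound ∧-comm      ρ = D.∧-comm _ _
    sound ∧-assoc     ρ = D.∧-assoc _ _ _
    sound ∨-absorbs-∧ ρ = D.∨-absorbs-∧ _ _
    sound ∧-absorbs-∨ ρ = D.∧-absorbs-∨ _ _
    sound ∨-distribʳ  ρ = D.∨-distribʳ-∧ _ _ _
    sound minimum     ρ = R.minimum _
    sound maximum     ρ = R.maximum _
    sound *-contra    ρ = proj₁ (R.isResidual (ρ 0))
    sound *-zero      ρ = proj₂ (R.isResidual _) _ (sym (R.minimum _))
    sound *-relative  ρ = proj₂ (R.isResidual (ρ 0)) _
      (trans (sym (D.∧-assoc _ _ _)) (proj₁ (R.isResidual (ρ 0 ∧ ρ 1))))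
    sound ⇒-eval      ρ = proj₁ (R.isResidual (ρ 0) (ρ 1))
    sound ⇒-unit      ρ = proj₂ (R.isResidual (ρ 0) _) (ρ 2) ≤-refl
    sound ⇒-mono      ρ = proj₂ (R.isResidual (ρ 0) (ρ 1)) _
      (≤-trans (proj₁ (R.isResidual (ρ 0) (ρ 2 ∧ ρ 1))) (x∧y≤y (ρ 2) (ρ 1)))
    sound ⁺-excl      ρ = proj₁ (R.isDualResidual (ρ 0))
    sound ⁺-one       ρ = proj₂ (R.isDualResidual _) _
      (trans (D.∨-comm _ _) (≤⇒∨ (R.minimum _)))
    sound ⁺-relative  ρ = proj₂ (R.isDualResidual (ρ 0)) _
      (trans (sym (D.∨-assoc _ _ _)) (proj₁ (R.isDualResidual (ρ 0 ∨ ρ 1))))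
    sound ⇐-eval      ρ = proj₁ (R.isDualResidual (ρ 0) (ρ 1))
    sound ⇐-unit      ρ = proj₂ (R.isDualResidual (ρ 0) _) (ρ 2) ≤-refl
    sound ⇐-mono      ρ = proj₂ (R.isDualResidual (ρ 0) (ρ 1)) _
      (≤-trans (x≤x∨y (ρ 1) (ρ 2)) (proj₁ (R.isDualResidual (ρ 0) (ρ 1 ∨ ρ 2))))
    sound {ε} regularity ρ = reg k k′ A R ρ
      where
      reg : ∀ k k′ (A : Algebra (Lang k k′) ℓ) → IsRegular A →
            A ⊨ ((x ∧ᵗ x ⁺ᵗ) ∨ᵗ (y ∨ᵗ y *ᵗ) ≋ y ∨ᵗ y *ᵗ)
      reg complement  complement  A R ρ = IsRegular.regularity R _ _
      reg complement  implication A R ρ = IsRegular.regularity R _ _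
      reg implication complement  A R ρ = IsRegular.regularity R _ _
      reg implication implication A R ρ = IsRegular.regularity R _ _

  Mod⇒IsRegular : ∀ {k k′ ℓ} → Mod (Basis k k′) ⊆ IsRegular {k} {k′} {ℓ}
  Mod⇒IsRegular {k} {k′} {ℓ} {A} A⊨ = record
    { isDistributiveLattice = isDL
    ; minimum        = λ a → A⊨ minimum (env a a a)
    ; maximum        = λ a → A⊨ maximum (env a a a)
    ; isResidual     = residual k A A⊨ isDL (λ a → A⊨ minimum (env a a a)) (λ a → A⊨ maximum (env a a a))
    ; isDualResidual = dualResidual k′ A A⊨ isDL (λ a → A⊨ minimum (env a a a)) (λ a → A⊨ maximum (env a a a))
    ; regularity     = reg k k′ A A⊨
    }
    where
    env : ∀ {c} {C : Set c} → C → C → C → ℕ → C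
    env a b c 0 = a
    env a b c 1 = b
    env a b c _ = c

    module _ {k k′ : Kind} (A : Algebra (Lang k k′) ℓ) where
      open Algebra A using (_≈_; interp)
      open Operations k k′ interp

      IsDL : Set ℓ
      IsDL = IsDistributiveLattice _≈_ _∨_ _∧_

      SatisfiesM : Set ℓ
      SatisfiesM = ∀ a b → (a ∧ a ⁺) ∨ (b ∨ b *) ≈ b ∨ b *

      Min Max : Set ℓ
      Min = ∀ a → _≤_ A 𝟎 a
      Max = ∀ a → _≤_ A a 𝟏

    isDL : IsDL A
    isDL = isDistributiveLatticeʳʲᵐ (record
      { isLattice = record
        { isEquivalence = Algebra.isEquivalence A
        ; ∨-comm        = λ a b → A⊨ ∨-comm (env a b b)
        ; ∨-assoc       = λ a b c → A⊨ ∨-assoc (env a b c)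
        ; ∨-cong        = λ p q → Algebra.interp-cong A join (p ∷ q ∷ [])
        ; ∧-comm        = λ a b → A⊨ ∧-comm (env a b b)
        ; ∧-assoc       = λ a b c → A⊨ ∧-assoc (env a b c)
        ; ∧-cong        = λ p q → Algebra.interp-cong A meet (p ∷ q ∷ [])
        ; absorptive    = (λ a b → A⊨ ∨-absorbs-∧ (env a b b)) , (λ a b → A⊨ ∧-absorbs-∨ (env a b b))
        }
      ; ∨-distribʳ-∧ = λ a b c → A⊨ ∨-distribʳ (env a b c)
      })

    reg : ∀ k k′ (A : Algebra (Lang k k′) ℓ) → A ∈ Mod (Basis k k′) →
          SatisfiesM A
    reg complement  complement  A A⊨ a b = A⊨ regularity (env a b b)
    reg complement  implication A A⊨ a b = A⊨ regularity (env a b b)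
    reg implication complement  A A⊨ a b = A⊨ regularity (env a b b)
    reg implication implication A A⊨ a b = A⊨ regularity (env a b b)

    residual : ∀ k {k′} (A : Algebra (Lang k k′) ℓ) → A ∈ Mod (Basis k k′) →
               IsDL A → Min A → Max A → IsResidual A k (Algebra.interp A res)
    residual complement A A⊨ dl min max a = A⊨ *-contra (env a a a) , λ b a∧b≈0 →
      ≤-trans (∧-greatest ≤-refl
                (≤-trans (max b) (≤-trans (A⊨ *-zero (env b b b))
                  (≤-reflexive (Algebra.interp-cong A res (sym a∧b≈0 ∷ []))))))
              (A⊨ *-relative (env a b b))
      where open Order dl
    residual implication A A⊨ dl min max a b = A⊨ ⇒-eval (env a b b) , λ c a∧c≤b →
      ≤-trans (A⊨ ⇒-unit (env a b c))
        (≤-trans (≤-reflexive (Algebra.interp-cong A res (refl ∷ a∧c≤b ∷ [])))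
                 (A⊨ ⇒-mono (env a b _)))
      where open Order dl

    dualResidual : ∀ k′ {k} (A : Algebra (Lang k k′) ℓ) → A ∈ Mod (Basis k k′) →
                   IsDL A → Min A → Max A → IsDualResidual A k′ (Algebra.interp A dres)
    dualResidual complement A A⊨ dl min max a = A⊨ ⁺-excl (env a a a) , λ b a∨b≈1 →
      ≤-trans (A⊨ ⁺-relative (env a b b))
              (∨-least ≤-refl
                (≤-trans (≤-reflexive (Algebra.interp-cong A dres (a∨b≈1 ∷ [])))
                         (≤-trans (A⊨ ⁺-one (env b b b)) (min b))))
      where open Order dl
    dualResidual implication A A⊨ dl min max a b = A⊨ ⇐-eval (env a b b) , λ c b≤a∨c →
      ≤-trans (A⊨ ⇐-mono (env a b _))
        (≤-trans (≤-reflexive (Algebra.interp-cong A dres (refl ∷ ≤⇒∨ b≤a∨c ∷ [])))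
                 (A⊨ ⇐-unit (env a b c)))
      where open Order dl

Regular : (k k′ : Kind) (ℓ : Level) → Variety (Lang k k′) ℓ
Regular k k′ ℓ = record
  { class       = IsRegular
  ; identities  = EquationalBasis.Basis k k′
  ; axiomatizes = EquationalBasis.IsRegular⇒Mod , EquationalBasis.Mod⇒IsRegular
  }

RDBLP : (ℓ : Level) → Variety (Lang complement complement) ℓ
RDBLP = Regular complement complement

RDPCH : (ℓ : Level) → Variety (Lang implication complement) ℓ
RDPCH = Regular implication complement

RPCHᵈ : (ℓ : Level) → Variety (Lang complement implication) ℓ
RPCHᵈ = Regular complement implication

RDBLH : (ℓ : Level) → Variety (Lang implication implication) ℓ
RDBLH = Regular implication implication

{-# OPTIONS --safe #-}

-- In a regular double p-algebra, Katriňák's term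
--   (x* ∨ y**)** ∧ ((x ∨ x*)⁺ ∨ x* ∨ y ∨ y*)
-- is the relative pseudocomplement x → y, and dually for x ← y.  Hence the
-- four varieties are term equivalent: the same translation of operations
-- turns an algebra of any of the four languages into one of any other, and
-- on regular algebras translating back and forth changes nothing, as
-- residuals are unique.  Pulling subvarieties back along these translations
-- gives mutually inverse monotone maps, that is, lattice isomorphisms.
module Submission where

open import Defs
open import Level using (Level; _⊔_)
open import Algebra.Core using (Op₁; Op₂)
open import Algebra.Lattice.Bundles using (DistributiveLattice)
open import Algebra.Lattice.Structures using (IsDistributiveLattice)
import Algebra.Lattice.Properties.DistributiveLattice as DistributiveLatticeProperties
open import Data.Product.Base using (_×_; _,_; proj₁; proj₂; ∃-syntax)
open import Data.Sum.Base using (_⊎_; inj₁; inj₂)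
open import Data.Nat.Base using (ℕ)
open import Data.Vec.Base using (Vec; []; _∷_)
open import Data.Vec.Relation.Binary.Pointwise.Inductive using (Pointwise; []; _∷_)
open import Function.Base using (id)
open import Relation.Binary.Core using (Rel)
import Relation.Binary.Lattice.Bundles as Ord
open import Relation.Binary.PropositionalEquality.Core as ≡ using (_≡_)
open import Relation.Unary using (Pred; _∈_; _⊆_; _≐_)

-- Order-theoretic criterion for lattice isomorphism

module _ {c ℓ₁ ℓ₂ c′ ℓ₁′ ℓ₂′}
         (L : Ord.Lattice c ℓ₁ ℓ₂) (M : Ord.Lattice c′ ℓ₁′ ℓ₂′) where
  private
    module L = Ord.Lattice L
    module M = Ord.Lattice M

  -- Mutually inverse monotone maps are adjoint to each other on both sides. Transposing across
  -- these adjunctions turns the universal properties of meets and joins in one lattice into those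
  -- in the other.
  orderIso⇒≅ : (f : L.Carrier → M.Carrier) (g : M.Carrier → L.Carrier) →
               (∀ {x y} → x L.≤ y → f x M.≤ f y) →
               (∀ {x y} → x M.≤ y → g x L.≤ g y) →
               (∀ x → g (f x) L.≈ x) → (∀ y → f (g y) M.≈ y) → L ≅ M
  orderIso⇒≅ f g f-mono g-mono gf fg = f , record
    { isLatticeMonomorphism = record
      { isLatticeHomomorphism = record
        { isRelHomomorphism = record { cong = f-cong }
        ; ∧-homo = λ x y → M.antisym
            (M.∧-greatest (f-mono (L.x∧y≤x x y)) (f-mono (L.x∧y≤y x y)))
            (g≤⇒≤f (L.∧-greatest (≤f⇒g≤ (M.x∧y≤x _ _)) (≤f⇒g≤ (M.x∧y≤y _ _))))
        ; ∨-homo = λ x y → M.antisym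
            (≤g⇒f≤ (L.∨-least (f≤⇒≤g (M.x≤x∨y _ _)) (f≤⇒≤g (M.y≤x∨y _ _))))
            (M.∨-least (f-mono (L.x≤x∨y x y)) (f-mono (L.y≤x∨y x y)))
        }
      ; injective = λ {x} {y} fx≈fy → L.antisym
          (L.trans (L.reflexive (L.Eq.sym (gf x)))
                   (≤f⇒g≤ (M.reflexive fx≈fy)))
          (L.trans (L.reflexive (L.Eq.sym (gf y)))
                   (≤f⇒g≤ (M.reflexive (M.Eq.sym fx≈fy))))
      }
    ; surjective = λ y → g y , λ z≈gy → M.Eq.trans (f-cong z≈gy) (fg y)
    }
    where
    f-cong : ∀ {x y} → x L.≈ y → f x M.≈ f y
    f-cong x≈y = M.antisym (f-mono (L.reflexive x≈y)) (f-mono (L.reflexive (L.Eq.sym x≈y)))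

    ≤f⇒g≤ : ∀ {x y} → y M.≤ f x → g y L.≤ x
    ≤f⇒g≤ y≤fx = L.trans (g-mono y≤fx) (L.reflexive (gf _))

    g≤⇒≤f : ∀ {x y} → g y L.≤ x → y M.≤ f x
    g≤⇒≤f gy≤x = M.trans (M.reflexive (M.Eq.sym (fg _))) (f-mono gy≤x)

    f≤⇒≤g : ∀ {x y} → f x M.≤ y → x L.≤ g y
    f≤⇒≤g fx≤y = L.trans (L.reflexive (L.Eq.sym (gf _))) (g-mono fx≤y)

    ≤g⇒f≤ : ∀ {x y} → x L.≤ g y → f x M.≤ y
    ≤g⇒f≤ x≤gy = M.trans (f-mono x≤gy) (M.reflexive (fg _))

-- Relative pseudocomplements in regular double p-algebras

-- The operations are parameters, so one formula serves terms and algebras alike, and exchanging `∨`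
-- with `∧` and `*` with `⁺` yields the formula for x ← y.
katriňák : ∀ {x} {X : Set x} (_∨_ _∧_ : Op₂ X) (_* _⁺ : Op₁ X) → Op₂ X
katriňák _∨_ _∧_ _* _⁺ x y =
  ((((x *) ∨ ((y *) *)) *) *) ∧ ((((x ∨ (x *)) ⁺) ∨ (x *)) ∨ (y ∨ (y *)))

katriňák-homo :
  ∀ {x y} {X : Set x} {Y : Set y}
  {_∨₁_ _∧₁_ : Op₂ X} {_*₁ _⁺₁ : Op₁ X} {_∨₂_ _∧₂_ : Op₂ Y} {_*₂ _⁺₂ : Op₁ Y}
  (h : X → Y) →
  (∀ a b → h (a ∨₁ b) ≡ h a ∨₂ h b) → (∀ a b → h (a ∧₁ b) ≡ h a ∧₂ h b) →
  (∀ a → h (a *₁) ≡ h a *₂) → (∀ a → h (a ⁺₁) ≡ h a ⁺₂) →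
  ∀ a b → h (katriňák _∨₁_ _∧₁_ _*₁ _⁺₁ a b) ≡ katriňák _∨₂_ _∧₂_ _*₂ _⁺₂ (h a) (h b)
katriňák-homo {_∨₁_ = _∨₁_} {_*₁ = _*₁} {_⁺₁ = _⁺₁} h h-∨ h-∧ h-* h-⁺ a b
  rewrite h-∧ (((((a *₁) ∨₁ ((b *₁) *₁)) *₁) *₁))
              ((((a ∨₁ (a *₁)) ⁺₁) ∨₁ (a *₁)) ∨₁ (b ∨₁ (b *₁)))
        | h-* (((a *₁) ∨₁ ((b *₁) *₁)) *₁) | h-* ((a *₁) ∨₁ ((b *₁) *₁))
        | h-∨ (a *₁) ((b *₁) *₁) | h-* (b *₁)
        | h-∨ (((a ∨₁ (a *₁)) ⁺₁) ∨₁ (a *₁)) (b ∨₁ (b *₁))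
        | h-∨ ((a ∨₁ (a *₁)) ⁺₁) (a *₁) | h-⁺ (a ∨₁ (a *₁)) | h-∨ a (a *₁)
        | h-∨ b (b *₁) | h-* a | h-* b = ≡.refl

katriňák-cong :
  ∀ {x ℓ} {X : Set x} {_≈_ : Rel X ℓ} {_∨_ _∧_ : Op₂ X} {_* _⁺ : Op₁ X} →
  (∀ {a b c d} → a ≈ b → c ≈ d → (a ∨ c) ≈ (b ∨ d)) →
  (∀ {a b c d} → a ≈ b → c ≈ d → (a ∧ c) ≈ (b ∧ d)) →
  (∀ {a b} → a ≈ b → (a *) ≈ (b *)) → (∀ {a b} → a ≈ b → (a ⁺) ≈ (b ⁺)) →
  ∀ {a b c d} → a ≈ b → c ≈ d →
  katriňák _∨_ _∧_ _* _⁺ a c ≈ katriňák _∨_ _∧_ _* _⁺ b d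
katriňák-cong ∨-cong ∧-cong *-cong ⁺-cong p q =
  ∧-cong (*-cong (*-cong (∨-cong (*-cong p) (*-cong (*-cong q)))))
         (∨-cong (∨-cong (⁺-cong (∨-cong p (*-cong p))) (*-cong p))
                 (∨-cong q (*-cong q)))

-- Every axiom is an inequality, with no trace of the language, so that the order dual is obtained
-- by exchanging the fields in pairs.
record IsRegularDoublePAlgebra {c ℓ} {C : Set c} (_≈_ : Rel C ℓ) (_∨_ _∧_ : Op₂ C)
                               (𝟎 𝟏 : C) (_* _⁺ : Op₁ C) : Set (c ⊔ ℓ) where
  field
    isDistributiveLattice : IsDistributiveLattice _≈_ _∨_ _∧_
  open Order isDistributiveLattice public
  field
    minimum    : ∀ x → 𝟎 ≤ x
    maximum    : ∀ x → x ≤ 𝟏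
    *-contra   : ∀ x → (x ∧ (x *)) ≤ 𝟎
    *-greatest : ∀ {x z} → (x ∧ z) ≤ 𝟎 → z ≤ (x *)
    ⁺-excl     : ∀ x → 𝟏 ≤ (x ∨ (x ⁺))
    ⁺-least    : ∀ {x z} → 𝟏 ≤ (x ∨ z) → (x ⁺) ≤ z
    regularity : ∀ x y → (x ∧ (x ⁺)) ≤ (y ∨ (y *))

  ∧-mono : ∀ {a b c d} → a ≤ b → c ≤ d → (a ∧ c) ≤ (b ∧ d)
  ∧-mono p q = ∧-greatest (≤-trans (x∧y≤x _ _) p) (≤-trans (x∧y≤y _ _) q)

  -- Case distinction inside an inequality, by distributivity. With `contra` and `*-intro`, it lets
  -- the proofs below read as natural deduction, the left-hand side being the context.
  ∨-elim : ∀ {a b p q} → a ≤ (p ∨ q) → (a ∧ p) ≤ b → (a ∧ q) ≤ b → a ≤ b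
  ∨-elim {a} {b} {p} {q} a≤p∨q ap≤b aq≤b = ≤-trans (∧-greatest ≤-refl a≤p∨q)
    (≤-trans (≤-reflexive (∧-distribˡ-∨ a p q)) (∨-least ap≤b aq≤b))

  contra : ∀ {a b x} → a ≤ x → a ≤ (x *) → a ≤ b
  contra {b = b} {x = x} p q = ≤-trans (∧-greatest p q) (≤-trans (*-contra x) (minimum b))

  *-intro : ∀ {x z} → (∀ {w} → w ≤ x → w ≤ z → w ≤ 𝟎) → z ≤ (x *)
  *-intro f = *-greatest (f (x∧y≤x _ _) (x∧y≤y _ _))

  *-antitone : ∀ {x y} → x ≤ y → (y *) ≤ (x *)
  *-antitone x≤y = *-intro λ w≤x w≤y* → contra (≤-trans w≤x x≤y) w≤y*

  ≤** : ∀ x → x ≤ ((x *) *)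
  ≤** x = *-intro λ w≤x* w≤x → contra w≤x w≤x*

  ***≤* : ∀ x → (((x *) *) *) ≤ (x *)
  ***≤* x = *-antitone (≤** x)

  -- (M) as an order version of: x* = y* and x⁺ = y⁺ imply x = y.
  quasiRegularity : ∀ {a b} → (a ∧ (b *)) ≤ 𝟎 → 𝟏 ≤ (b ∨ (a ⁺)) → a ≤ b
  quasiRegularity {a} {b} ab*≤0 1≤b∨a⁺ =
    ∨-elim (≤-trans (maximum a) 1≤b∨a⁺) (x∧y≤y a b)
      (∨-elim (regularity a b) (x∧y≤y _ b)
        (≤-trans (∧-mono (x∧y≤x a _) ≤-refl) (≤-trans ab*≤0 (minimum b))))

  _⇒_ : Op₂ C
  _⇒_ = katriňák _∨_ _∧_ _* _⁺

  -- The second factor of the term places x ∧ (x ⇒ y) below y ∨ y*, and the first factor refutes the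
  -- case y*: below both x and y*, nothing meets x* ∨ y**.
  ⇒-eval : ∀ x y → (x ∧ (x ⇒ y)) ≤ y
  ⇒-eval x y = ∨-elim a≤y∨y* (x∧y≤y _ y)
    (contra
      (*-intro λ w≤x*∨y** w≤ → ∨-elim w≤x*∨y**
        (contra (≤-trans (x∧y≤x _ _) (≤-trans w≤ (≤-trans (x∧y≤x _ _) (x∧y≤x _ _)))) (x∧y≤y _ _))
        (contra (≤-trans (x∧y≤x _ _) (≤-trans w≤ (x∧y≤y _ _))) (x∧y≤y _ _)))
      (≤-trans (x∧y≤x _ _) (≤-trans (x∧y≤y x _) (x∧y≤x _ _))))
    where
    a≤y∨y* : (x ∧ (x ⇒ y)) ≤ (y ∨ (y *))
    a≤y∨y* = ∨-elim (≤-trans (x∧y≤y x _) (x∧y≤y _ _))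
      (∨-elim (x∧y≤y _ _)
        -- As x ≤ x ∨ x*, the case (x ∨ x*)⁺ is an instance of (M) at x ∨ x*.
        (≤-trans
          (∧-mono (≤-trans (x∧y≤x _ _) (≤-trans (x∧y≤x x _) (x≤x∨y x (x *)))) ≤-refl)
          (regularity (x ∨ (x *)) y))
        (contra (≤-trans (x∧y≤x _ _) (≤-trans (x∧y≤x _ _) (x∧y≤x x _))) (x∧y≤y _ _)))
      (x∧y≤y _ _)

  ⇒-greatest : ∀ {x y z} → (x ∧ z) ≤ y → z ≤ (x ⇒ y)
  ⇒-greatest {x} {y} {z} xz≤y = ∧-greatest
    -- An element w below both (x* ∨ y**)* and z is below x** and y*. Since x ∧ z ≤ y, it meets x in
    -- 0, hence is below x* too and vanishes.
    (*-intro λ w≤[x*∨y**]* w≤z →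
      contra
        (*-intro λ v≤x v≤w → contra
          (≤-trans (∧-greatest v≤x (≤-trans v≤w w≤z)) xz≤y)
          (≤-trans v≤w (≤-trans w≤[x*∨y**]*
            (≤-trans (*-antitone (y≤x∨y (x *) ((y *) *))) (***≤* y)))))
        (≤-trans w≤[x*∨y**]* (*-antitone (x≤x∨y (x *) ((y *) *)))))
    -- Regularity is applied to z and the second factor s. The first condition holds since s lies
    -- above y ∨ y*, whose pseudocomplement is 0.
    (quasiRegularity
      (contra
        (≤-trans (x∧y≤y z _) (*-antitone (≤-trans (x≤x∨y y (y *)) r≤s)))
        (≤-trans (x∧y≤y z _) (*-antitone (≤-trans (y≤x∨y y (y *)) r≤s))))
      -- The top is split along z ∨ z⁺ and then (x ∨ x*) ∨ (x ∨ x*)⁺. The only case not already a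
      -- summand of the goal is x ∧ z, which is below y by hypothesis.
      (∨-elim (⁺-excl z)
        (∨-elim (≤-trans (x∧y≤x _ _) (⁺-excl (x ∨ (x *))))
          (∨-elim (x∧y≤y _ _)
            (≤-trans (∧-greatest (x∧y≤y _ _) (≤-trans (x∧y≤x _ _) (≤-trans (x∧y≤x _ _) (x∧y≤y _ _))))
              (≤-trans xz≤y (≤-trans (x≤x∨y y (y *)) (≤-trans r≤s s≤))))
            (≤-trans (x∧y≤y _ _) (≤-trans (y≤x∨y _ _) (≤-trans l≤s s≤))))
          (≤-trans (x∧y≤y _ _) (≤-trans (x≤x∨y _ _) (≤-trans l≤s s≤))))
        (≤-trans (x∧y≤y _ _) (y≤x∨y _ _))))
    where
    l r s : C
    l = ((x ∨ (x *)) ⁺) ∨ (x *)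
    r = y ∨ (y *)
    s = l ∨ r
    l≤s : l ≤ s
    l≤s = x≤x∨y l r
    r≤s : r ≤ s
    r≤s = y≤x∨y l r
    s≤ : s ≤ (s ∨ (z ⁺))
    s≤ = x≤x∨y s (z ⁺)

-- Dual relative pseudocomplements, by order duality

module _ {c ℓ} {C : Set c} {_≈_ : Rel C ℓ} {_∨_ _∧_ : Op₂ C} {𝟎 𝟏 : C} {_* _⁺ : Op₁ C}
         (R : IsRegularDoublePAlgebra _≈_ _∨_ _∧_ 𝟎 𝟏 _* _⁺) where
  private
    open IsRegularDoublePAlgebra R

    D : DistributiveLattice c ℓ
    D = record { isDistributiveLattice = isDistributiveLattice }

    toDual : ∀ {x y} → x ≤ y → y ≈ (y ∨ x)
    toDual x≤y = sym (trans (∨-comm _ _) (≤⇒∨ x≤y))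

    fromDual : ∀ {x y} → y ≈ (y ∨ x) → x ≤ y
    fromDual y≈y∨x = ≤-trans (y≤x∨y _ _) (≤-reflexive (sym y≈y∨x))

    -- The identity (M) is self-dual up to exchanging its two variables, so regular double
    -- p-algebras are closed under order duals.
    dual : IsRegularDoublePAlgebra _≈_ _∧_ _∨_ 𝟏 𝟎 _⁺ _*
    dual = record
      { isDistributiveLattice = DistributiveLatticeProperties.∧-∨-isDistributiveLattice D
      ; minimum    = λ x → toDual (maximum x)
      ; maximum    = λ x → toDual (minimum x)
      ; *-contra   = λ x → toDual (⁺-excl x)
      ; *-greatest = λ p → toDual (⁺-least (fromDual p))
      ; ⁺-excl     = λ x → toDual (*-contra x)
      ; ⁺-least    = λ p → toDual (*-greatest (fromDual p))
      ; regularity = λ x y → toDual (regularity y x)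
      }

    module Dual = IsRegularDoublePAlgebra dual

  ⇐-eval : ∀ x y → y ≤ (x ∨ katriňák _∧_ _∨_ _⁺ _* x y)
  ⇐-eval x y = fromDual (Dual.⇒-eval x y)

  ⇐-least : ∀ {x y z} → y ≤ (x ∨ z) → katriňák _∧_ _∨_ _⁺ _* x y ≤ z
  ⇐-least p = fromDual (Dual.⇒-greatest (toDual p))

-- Translation between the four languages

module _ {x} {X : Set x} (k k′ : Kind)
         (⟦_⟧ : (o : Symbol) → Vec X (arity (Lang k k′) o) → X) where
  open Operations k k′ ⟦_⟧

  -- An implication is rebuilt from `*` and `⁺` even when the source language has one; that the two
  -- agree on regular algebras follows from uniqueness of residuals.
  residual : (j : Kind) → Vec X (kindArity j) → X
  residual complement  (x ∷ [])     = x *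
  residual implication (x ∷ y ∷ []) = katriňák _∨_ _∧_ _* _⁺ x y

  dualResidual : (j : Kind) → Vec X (kindArity j) → X
  dualResidual complement  (x ∷ [])     = x ⁺
  dualResidual implication (x ∷ y ∷ []) = katriňák _∧_ _∨_ _⁺ _* x y

  -- On terms this is the translation of languages, on an algebra the change of its operations.
  derived : (j j′ : Kind) (o : Symbol) → Vec X (arity (Lang j j′) o) → X
  derived j j′ join = ⟦ join ⟧
  derived j j′ meet = ⟦ meet ⟧
  derived j j′ zero = ⟦ zero ⟧
  derived j j′ one  = ⟦ one ⟧
  derived j j′ res  = residual j
  derived j j′ dres = dualResidual j′

module _ {k k′ j j′ : Kind} where

  translate  : Term (Lang j j′) → Term (Lang k k′)
  translates : ∀ {n} → Vec (Term (Lang j j′)) n → Vec (Term (Lang k k′)) n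

  translate (var i)   = var i
  translate (op o ts) = derived k k′ op j j′ o (translates ts)

  translates []       = []
  translates (t ∷ ts) = translate t ∷ translates ts

  translateIdentity : Identity (Lang j j′) → Identity (Lang k k′)
  translateIdentity (s ≋ t) = translate s ≋ translate t

-- Reducts and the evaluation of translated terms

module _ {ℓ : Level} where

  *-cong : ∀ {k k′} (A : Algebra (Lang k k′) ℓ) → let open Algebra A in
           let open Operations k k′ interp in ∀ {x y} → x ≈ y → x * ≈ y *
  *-cong {complement}  A p = Algebra.interp-cong A res (p ∷ [])
  *-cong {implication} A p = Algebra.interp-cong A res (p ∷ Algebra.refl A ∷ [])

  ⁺-cong : ∀ {k k′} (A : Algebra (Lang k k′) ℓ) → let open Algebra A in
           let open Operations k k′ interp in ∀ {x y} → x ≈ y → x ⁺ ≈ y ⁺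
  ⁺-cong {k′ = complement}  A p = Algebra.interp-cong A dres (p ∷ [])
  ⁺-cong {k′ = implication} A p = Algebra.interp-cong A dres (p ∷ Algebra.refl A ∷ [])

  -- Both sides compute only once the kind is known, because `star` is defined by cases on it.
  eval-* : ∀ {k k′} (A : Algebra (Lang k k′) ℓ) ρ t →
           eval A ρ (Operations._* k k′ op t) ≡ Operations._* k k′ (Algebra.interp A) (eval A ρ t)
  eval-* {complement}  A ρ t = ≡.refl
  eval-* {implication} A ρ t = ≡.refl

  eval-⁺ : ∀ {k k′} (A : Algebra (Lang k k′) ℓ) ρ t →
           eval A ρ (Operations._⁺ k k′ op t) ≡ Operations._⁺ k k′ (Algebra.interp A) (eval A ρ t)
  eval-⁺ {k′ = complement}  A ρ t = ≡.refl
  eval-⁺ {k′ = implication} A ρ t = ≡.refl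

  module _ {k k′ : Kind} (A : Algebra (Lang k k′) ℓ) where
    open Algebra A using (Carrier; _≈_; setoid; interp; interp-cong)

    private
      ∨-cong : ∀ {a b c d} → a ≈ b → c ≈ d → interp join (a ∷ c ∷ []) ≈ interp join (b ∷ d ∷ [])
      ∨-cong p q = interp-cong join (p ∷ q ∷ [])

      ∧-cong : ∀ {a b c d} → a ≈ b → c ≈ d → interp meet (a ∷ c ∷ []) ≈ interp meet (b ∷ d ∷ [])
      ∧-cong p q = interp-cong meet (p ∷ q ∷ [])

    residual-cong : ∀ j {xs ys} → Pointwise _≈_ xs ys →
                    residual k k′ interp j xs ≈ residual k k′ interp j ys
    residual-cong complement  (p ∷ [])     = *-cong A p
    residual-cong implication (p ∷ q ∷ []) =
      katriňák-cong {_≈_ = _≈_} ∨-cong ∧-cong (*-cong A) (⁺-cong A) p q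

    dualResidual-cong : ∀ j {xs ys} → Pointwise _≈_ xs ys →
                        dualResidual k k′ interp j xs ≈ dualResidual k k′ interp j ys
    dualResidual-cong complement  (p ∷ [])     = ⁺-cong A p
    dualResidual-cong implication (p ∷ q ∷ []) =
      katriňák-cong {_≈_ = _≈_} ∧-cong ∨-cong (⁺-cong A) (*-cong A) p q

    derived-cong : ∀ j j′ o {xs ys} → Pointwise _≈_ xs ys →
                   derived k k′ interp j j′ o xs ≈ derived k k′ interp j j′ o ys
    derived-cong j j′ join = interp-cong join
    derived-cong j j′ meet = interp-cong meet
    derived-cong j j′ zero = interp-cong zero
    derived-cong j j′ one  = interp-cong one
    derived-cong j j′ res  = residual-cong j
    derived-cong j j′ dres = dualResidual-cong j′

    -- Defined for every algebra; regularity enters later, to identify the derived operations as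
    -- residuals.
    reduct : (j j′ : Kind) → Algebra (Lang j j′) ℓ
    reduct j j′ = record
      { setoid      = setoid
      ; interp      = derived k k′ interp j j′
      ; interp-cong = derived-cong j j′
      }

    private
      module T = Operations k k′ (op {Lang k k′})
      module C = Operations k k′ interp

    module _ (ρ : ℕ → Carrier) where

      eval-residual : ∀ j ts → eval A ρ (residual k k′ op j ts) ≡ residual k k′ interp j (evals A ρ ts)
      eval-residual complement  (t ∷ [])     = eval-* A ρ t
      eval-residual implication (s ∷ t ∷ []) = katriňák-homo
        {_∨₁_ = T._∨_} {T._∧_} {T._*} {T._⁺} {C._∨_} {C._∧_} {C._*} {C._⁺}
        (eval A ρ) (λ _ _ → ≡.refl) (λ _ _ → ≡.refl) (eval-* A ρ) (eval-⁺ A ρ) s t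

      eval-dualResidual : ∀ j ts →
        eval A ρ (dualResidual k k′ op j ts) ≡ dualResidual k k′ interp j (evals A ρ ts)
      eval-dualResidual complement  (t ∷ [])     = eval-⁺ A ρ t
      eval-dualResidual implication (s ∷ t ∷ []) = katriňák-homo
        {_∨₁_ = T._∧_} {T._∨_} {T._⁺} {T._*} {C._∧_} {C._∨_} {C._⁺} {C._*}
        (eval A ρ) (λ _ _ → ≡.refl) (λ _ _ → ≡.refl) (eval-⁺ A ρ) (eval-* A ρ) s t

      eval-derived : ∀ j j′ o ts →
        eval A ρ (derived k k′ op j j′ o ts) ≡ derived k k′ interp j j′ o (evals A ρ ts)
      eval-derived j j′ join ts = ≡.refl
      eval-derived j j′ meet ts = ≡.refl
      eval-derived j j′ zero ts = ≡.refl
      eval-derived j j′ one  ts = ≡.refl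
      eval-derived j j′ res  ts = eval-residual j ts
      eval-derived j j′ dres ts = eval-dualResidual j′ ts

      module _ {j j′ : Kind} where

        eval-translate  : ∀ t → eval A ρ (translate t) ≡ eval (reduct j j′) ρ t
        evals-translate : ∀ {n} (ts : Vec _ n) →
                          evals A ρ (translates ts) ≡ evals (reduct j j′) ρ ts

        eval-translate (var i)   = ≡.refl
        eval-translate (op o ts) = ≡.trans (eval-derived j j′ o (translates ts))
          (≡.cong (derived k k′ interp j j′ o) (evals-translate ts))

        evals-translate []       = ≡.refl
        evals-translate (t ∷ ts) = ≡.cong₂ _∷_ (eval-translate t) (evals-translate ts)

    module _ {j j′ : Kind} where

      -- With its converse, this makes a condition on reducts equational: if the reducts are to
      -- satisfy given identities, the algebras must satisfy the translated ones.
      ⊨-translate⁺ : ∀ ε → reduct j j′ ⊨ ε → A ⊨ translateIdentity ε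
      ⊨-translate⁺ (s ≋ t) A°⊨ε ρ =
        ≡.subst₂ _≈_ (≡.sym (eval-translate ρ s)) (≡.sym (eval-translate ρ t)) (A°⊨ε ρ)

      ⊨-translate⁻ : ∀ ε → A ⊨ translateIdentity ε → reduct j j′ ⊨ ε
      ⊨-translate⁻ (s ≋ t) A⊨ε′ ρ =
        ≡.subst₂ _≈_ (eval-translate ρ s) (eval-translate ρ t) (A⊨ε′ ρ)

-- Algebras with the same operations

module _ {S : Signature} {ℓ : Level} (A : Algebra S ℓ) where
  open Algebra A

  module _ {f : (o : Op S) → Vec Carrier (arity S o) → Carrier}
           {f-cong : ∀ o {xs ys} → Pointwise _≈_ xs ys → f o xs ≈ f o ys}
           (f≈interp : ∀ o xs → f o xs ≈ interp o xs) where
    private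
      B : Algebra S ℓ
      B = record { setoid = setoid; interp = f; interp-cong = f-cong }

    eval-interp  : ∀ ρ t → eval B ρ t ≈ eval A ρ t
    evals-interp : ∀ ρ {n} (ts : Vec _ n) → Pointwise _≈_ (evals B ρ ts) (evals A ρ ts)

    eval-interp ρ (var i)   = refl
    eval-interp ρ (op o ts) = trans (f≈interp o _) (interp-cong o (evals-interp ρ ts))

    evals-interp ρ []       = []
    evals-interp ρ (t ∷ ts) = eval-interp ρ t ∷ evals-interp ρ ts

    -- A double reduct recovers the original operations only up to `≈`. An arbitrary predicate might
    -- notice the difference, but one axiomatized by identities cannot.
    class-interp⁺ : (W : Variety S ℓ) → A ∈ class W → B ∈ class W
    class-interp⁺ W A∈W = proj₂ (axiomatizes W) λ {(s ≋ t)} ε∈W ρ →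
      trans (eval-interp ρ s) (trans (proj₁ (axiomatizes W) A∈W ε∈W ρ) (sym (eval-interp ρ t)))

    class-interp⁻ : (W : Variety S ℓ) → B ∈ class W → A ∈ class W
    class-interp⁻ W B∈W = proj₂ (axiomatizes W) λ {(s ≋ t)} ε∈W ρ →
      trans (sym (eval-interp ρ s)) (trans (proj₁ (axiomatizes W) B∈W ε∈W ρ) (eval-interp ρ t))

-- Term equivalence of the regular varieties

-- Judgemental only once the kind i is known, hence the case split.
module _ {ℓ : Level} {k k′ j j′ : Kind} (A : Algebra (Lang k k′) ℓ) where

  IsResidual-reduct : ∀ i {f} →
    Regularity.IsResidual A i f ≡ Regularity.IsResidual (reduct A j j′) i f
  IsResidual-reduct complement  = ≡.refl
  IsResidual-reduct implication = ≡.refl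

  IsDualResidual-reduct : ∀ i {f} →
    Regularity.IsDualResidual A i f ≡ Regularity.IsDualResidual (reduct A j j′) i f
  IsDualResidual-reduct complement  = ≡.refl
  IsDualResidual-reduct implication = ≡.refl

module _ {ℓ : Level} {k k′ : Kind} (A : Algebra (Lang k k′) ℓ) where
  open Algebra A using (_≈_; interp)
  open Operations k k′ interp
  open Regularity A using (IsResidual; IsDualResidual)

  module _ (isDL : IsDistributiveLattice _≈_ _∨_ _∧_) where
    open Order isDL

    residual-unique : ∀ j {f g} → IsResidual j f → IsResidual j g → ∀ xs → f xs ≈ g xs
    residual-unique complement  F G (x ∷ [])     =
      antisym (proj₂ (G x) _ (proj₁ (F x))) (proj₂ (F x) _ (proj₁ (G x)))
    residual-unique implication F G (x ∷ y ∷ []) =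
      antisym (proj₂ (G x y) _ (proj₁ (F x y))) (proj₂ (F x y) _ (proj₁ (G x y)))

    dualResidual-unique : ∀ j {f g} → IsDualResidual j f → IsDualResidual j g → ∀ xs → f xs ≈ g xs
    dualResidual-unique complement  F G (x ∷ [])     =
      antisym (proj₂ (F x) _ (proj₁ (G x))) (proj₂ (G x) _ (proj₁ (F x)))
    dualResidual-unique implication F G (x ∷ y ∷ []) =
      antisym (proj₂ (F x y) _ (proj₁ (G x y))) (proj₂ (G x y) _ (proj₁ (F x y)))

    module _ (minimum : ∀ x → 𝟎 ≤ x) (maximum : ∀ x → x ≤ 𝟏) where

      -- Brings the basic `*` and x → 0 to one common form, the lower bound 0 turning x ∧ z ≤ 0 into
      -- an equality.
      star-isResidual : ∀ j {f} → IsResidual j f →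
        ∀ x → ((x ∧ star j f x) ≤ 𝟎) × (∀ {z} → (x ∧ z) ≤ 𝟎 → z ≤ star j f x)
      star-isResidual complement  F x =
        ≤-reflexive (proj₁ (F x)) , λ p → proj₂ (F x) _ (antisym p (minimum _))
      star-isResidual implication F x = proj₁ (F x 𝟎) , proj₂ (F x 𝟎) _

      plus-isDualResidual : ∀ j {f} → IsDualResidual j f →
        ∀ x → (𝟏 ≤ (x ∨ plus j f x)) × (∀ {z} → 𝟏 ≤ (x ∨ z) → plus j f x ≤ z)
      plus-isDualResidual complement  F x =
        ≤-reflexive (sym (proj₁ (F x))) , λ p → proj₂ (F x) _ (antisym (maximum _) p)
      plus-isDualResidual implication F x = proj₁ (F x 𝟏) , proj₂ (F x 𝟏) _

module _ {ℓ : Level} {k k′ : Kind} {A : Algebra (Lang k k′) ℓ} where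
  open Algebra A using (_≈_; interp)
  open Operations k k′ interp
  open Regularity A using (IsResidual; IsDualResidual)

  module _ (A∈R : IsRegular A) where
    private
      module R = IsRegular A∈R
      module O = Order R.isDistributiveLattice
      ⋆ = star-isResidual A R.isDistributiveLattice R.minimum R.maximum k R.isResidual
      ✚ = plus-isDualResidual A R.isDistributiveLattice R.minimum R.maximum k′ R.isDualResidual

    isRegularDoublePAlgebra : IsRegularDoublePAlgebra _≈_ _∨_ _∧_ 𝟎 𝟏 _* _⁺
    isRegularDoublePAlgebra = record
      { isDistributiveLattice = R.isDistributiveLattice
      ; minimum    = R.minimum
      ; maximum    = R.maximum
      ; *-contra   = λ x → proj₁ (⋆ x)
      ; *-greatest = λ {x} → proj₂ (⋆ x)
      ; ⁺-excl     = λ x → proj₁ (✚ x)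
      ; ⁺-least    = λ {x} → proj₂ (✚ x)
      ; regularity = λ x y → O.≤-trans (O.x≤x∨y _ _) (O.≤-reflexive (R.regularity x y))
      }

    private
      module P = IsRegularDoublePAlgebra isRegularDoublePAlgebra

    residual-isResidual : ∀ j → IsResidual j (residual k k′ interp j)
    residual-isResidual complement  x   =
      P.antisym (P.*-contra x) (P.minimum _) , λ _ p → P.*-greatest (P.≤-reflexive p)
    residual-isResidual implication x y = P.⇒-eval x y , λ _ → P.⇒-greatest

    dualResidual-isDualResidual : ∀ j → IsDualResidual j (dualResidual k k′ interp j)
    dualResidual-isDualResidual complement  x   =
      P.antisym (P.maximum _) (P.⁺-excl x) , λ _ p → P.⁺-least (P.≤-reflexive (P.sym p))
    dualResidual-isDualResidual implication x y =
      ⇐-eval isRegularDoublePAlgebra x y , λ _ → ⇐-least isRegularDoublePAlgebra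

    reduct-isRegular : ∀ j j′ → IsRegular (reduct A j j′)
    reduct-isRegular j j′ = record
      { isDistributiveLattice = R.isDistributiveLattice
      ; minimum               = R.minimum
      ; maximum               = R.maximum
      ; isResidual            = isResidual°
      ; isDualResidual        = isDualResidual°
      -- The pseudocomplements of the reduct may be given by different expressions from those of
      -- `A`. Extremality bounds the new x⁺ by the old one and the old y* by the new one, and (M)
      -- carries over.
      ; regularity            = λ x y → P.≤⇒∨ (P.≤-trans
          (P.∧-mono P.≤-refl (proj₂ (✚° x) (P.⁺-excl x)))
          (P.≤-trans (P.regularity x y)
            (P.∨-least (P.x≤x∨y _ _)
              (P.≤-trans (proj₂ (⋆° y) (P.*-contra y)) (P.y≤x∨y _ _)))))
      }
      where
      A° = reduct A j j′
      isResidual° = ≡.subst id (IsResidual-reduct A j) (residual-isResidual j)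
      isDualResidual° = ≡.subst id (IsDualResidual-reduct A j′) (dualResidual-isDualResidual j′)
      ⋆° = star-isResidual A° R.isDistributiveLattice R.minimum R.maximum j isResidual°
      ✚° = plus-isDualResidual A° R.isDistributiveLattice R.minimum R.maximum j′ isDualResidual°

module _ {ℓ : Level} {k k′ : Kind} {A : Algebra (Lang k k′) ℓ}
         (A∈R : IsRegular A) (j j′ : Kind) where
  open Algebra A using (_≈_; refl; interp)

  -- The reduct is regular and has the same order, so the operations rebuilt from it are residuals
  -- in `A` as well, and these are unique.
  reduct-involutive : ∀ o xs →
    derived j j′ (derived k k′ interp j j′) k k′ o xs ≈ interp o xs
  reduct-involutive join xs = refl
  reduct-involutive meet xs = refl
  reduct-involutive zero xs = refl
  reduct-involutive one  xs = refl
  reduct-involutive res  xs = residual-unique A (IsRegular.isDistributiveLattice A∈R) k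
    (≡.subst id (≡.sym (IsResidual-reduct A k)) (residual-isResidual (reduct-isRegular A∈R j j′) k))
    (IsRegular.isResidual A∈R) xs
  reduct-involutive dres xs = dualResidual-unique A (IsRegular.isDistributiveLattice A∈R) k′
    (≡.subst id (≡.sym (IsDualResidual-reduct A k′))
      (dualResidual-isDualResidual (reduct-isRegular A∈R j j′) k′))
    (IsRegular.isDualResidual A∈R) xs

-- Pulling back subvarieties and the isomorphisms

module _ {ℓ : Level} {k k′ j j′ : Kind} where

  pullback : Subvariety (Regular k k′ ℓ) → Subvariety (Regular j j′ ℓ)
  pullback (W , _) = record
    { class       = K
    ; identities  = E
    ; axiomatizes = sound , complete
    } , proj₁
    where
    K : Pred (Algebra (Lang j j′) ℓ) _
    -- Regularity of `B` is required separately: the reduct sees implications of `B` only through x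
    -- → 0 and x ← 1, so it may be regular when `B` is not. Accordingly the axioms are the basis
    -- together with the translated identities of `W`.
    K B = IsRegular B × reduct B k k′ ∈ class W

    E : Identities (Lang j j′) ℓ
    E ε = ε ∈ EquationalBasis.Basis {ℓ} j j′
        ⊎ ∃[ δ ] (δ ∈ identities W × ε ≡ translateIdentity δ)

    sound : K ⊆ Mod E
    sound {B} (B∈R , B°∈W) (inj₁ ε∈Basis)            = EquationalBasis.IsRegular⇒Mod B∈R ε∈Basis
    sound {B} (B∈R , B°∈W) (inj₂ (δ , δ∈W , ≡.refl)) =
      ⊨-translate⁺ B δ (proj₁ (axiomatizes W) B°∈W δ∈W)

    complete : Mod E ⊆ K
    complete {B} B⊨ =
        EquationalBasis.Mod⇒IsRegular (λ ε∈Basis → B⊨ (inj₁ ε∈Basis))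
      , proj₂ (axiomatizes W) λ {δ} δ∈W →
          ⊨-translate⁻ B δ (B⊨ (inj₂ (δ , δ∈W , ≡.refl)))

-- Membership in the double pullback is a statement about the double reduct, which `W` cannot tell
-- from the regular algebra itself.
pullback-inverse : ∀ {ℓ} {k k′ j j′} (W : Subvariety (Regular k k′ ℓ)) →
  members (Regular k k′ ℓ) (pullback (pullback {j = j} {j′} W)) ≐ members (Regular k k′ ℓ) W
pullback-inverse {j = j} {j′} (W , W⊆R) =
    (λ {A} (A∈R , _ , A°°∈W) → class-interp⁻ A (reduct-involutive A∈R j j′) W A°°∈W)
  , (λ {A} A∈W → let A∈R = W⊆R A∈W in
       A∈R , reduct-isRegular A∈R j j′ , class-interp⁺ A (reduct-involutive A∈R j j′) W A∈W)

𝓛ᵥ-Regular-≅ : ∀ (ℓ : Level) k k′ j j′ → 𝓛ᵥ (Regular k k′ ℓ) ≅ 𝓛ᵥ (Regular j j′ ℓ)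
𝓛ᵥ-Regular-≅ ℓ k k′ j j′ = orderIso⇒≅ (𝓛ᵥ (Regular k k′ ℓ)) (𝓛ᵥ (Regular j j′ ℓ)) pullback pullback
  (λ V⊆W (B∈R , B°∈V) → B∈R , V⊆W B°∈V)
  (λ V⊆W (B∈R , B°∈V) → B∈R , V⊆W B°∈V)
  pullback-inverse pullback-inverse

corollary2p7 : ∀ (ℓ : Level) →
    (𝓛ᵥ (RDBLP ℓ) ≅ 𝓛ᵥ (RDPCH ℓ)) ×
    (𝓛ᵥ (RDPCH ℓ) ≅ 𝓛ᵥ (RPCHᵈ ℓ)) ×
    (𝓛ᵥ (RPCHᵈ ℓ) ≅ 𝓛ᵥ (RDBLH ℓ))
corollary2p7 ℓ =
    𝓛ᵥ-Regular-≅ ℓ complement complement implication complement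
  , 𝓛ᵥ-Regular-≅ ℓ implication complement complement implication
  , 𝓛ᵥ-Regular-≅ ℓ complement implication implication implication
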